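{- Let $\lambda\in\mathbb{R}$ and $r\in\mathbb{N}\cup\{0\}$. For every integer $n\ge0$, the following identities hold (as polynomials in the variable $x$): $$Bel_{n,\lambda}^{(r)}(x)=\sum_{k=0}^{n}x^k\,S_{2,r}(n+r,k+r|\lambda)=\sum_{k=0}^{n}\left(\sum_{m=k}^{n}\sum_{l=0}^{n-m}r^l\,\lambda^{n-m-l}\,S_1(n-m,l)\,S_{2,\lambda}(m,k)\binom{n}{m}\right)x^k.$$
   Context: All generating functions are formal power series in $t$. For a number $y$, $(1+\lambda t)^{y/\lambda}$ denotes the formal power series $\sum_{n\ge0}(y|\lambda)_n\frac{t^n}{n!}$, where $(y|\lambda)_0=1$ and $(y|\lambda)_n=y(y-\lambda)(y-2\lambda)\cdots(y-(n-1)\lambda)$ for $n\ge1$ (for $\lambda=0$ this is the limit $e^{yt}$). The convention $0^0=1$ is used. The (signed) Stirling numbers of the first kind $S_1(n,k)$ are defined by $(x)_n=\sum_{k=0}^n S_1(n,k)x^k$, where $(x)_0=1$ and $(x)_n=x(x-1)\cdots(x-n+1)$ for $n\ge1$. The degenerate Stirling numbers of the second kind $S_{2,\lambda}(n,k)$ are defined, for $k\ge0$, by $$\frac{1}{k!}\left((1+\lambda t)^{1/\lambda}-1\right)^k=\sum_{n=k}^\infty S_{2,\lambda}(n,k)\frac{t^n}{n!}.$$ The extended degenerate Stirling numbers of the second kind $S_{2,r}(n+r,k+r|\lambda)$ are defined, for $r,k\in\mathbb{N}\cup\{0\}$, by $$\frac{1}{k!}(1+\lambda t)^{r/\lambda}\left((1+\lambda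 t)^{1/\lambda}-1\right)^k=\sum_{n=k}^\infty S_{2,r}(n+r,k+r|\lambda)\frac{t^n}{n!}.$$ The extended degenerate Bell polynomials $Bel_{n,\lambda}^{(r)}(x)$ are defined by $$(1+\lambda t)^{r/\lambda}\,e^{x\left((1+\lambda t)^{1/\lambda}-1\right)}=\sum_{n=0}^\infty Bel_{n,\lambda}^{(r)}(x)\frac{t^n}{n!}.$$ -}

module Defs where

open import Algebra.Bundles using (CommutativeRing)
open import Algebra.Bundles.Raw using (RawRing)
import Algebra.Definitions.RawSemiring as RawSemiringDefinitions
open import Data.Fin.Base using (toℕ)
open import Data.List.Base using (List; []; _∷_; map)
open import Data.Nat.Base as ℕ using (ℕ; zero; suc; _∸_; _!; NonZero)
open import Data.Nat.Properties using (_!≢0)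
open import Level using (_⊔_)

module RingNotation {a ℓ} (A : RawRing a ℓ) where
  open RawRing A
  open RawSemiringDefinitions rawSemiring public using (_×_; _^_; sum)

  ι : ℕ → Carrier
  ι n = n × 1#

  -- ∑ a b f = f a + f (a + 1) + ⋯ + f b, which is empty when b < a.
  ∑ : ℕ → ℕ → (ℕ → Carrier) → Carrier
  ∑ a b f = sum {suc b ∸ a} (λ i → f (a ℕ.+ toℕ i))

  -- falling ƛ y n = y (y - ƛ) (y - 2ƛ) ⋯ (y - (n - 1)ƛ)
  falling : Carrier → Carrier → ℕ → Carrier
  falling ƛ y zero    = 1#
  falling ƛ y (suc n) = falling ƛ y n * (y + - (n × ƛ))

-- A commutative ring in which every positive integer is invertible, i.e. a
-- commutative ℚ-algebra.  The real numbers are the motivating instance.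
record ℚAlgebra {c ℓ} (R : CommutativeRing c ℓ) : Set (c ⊔ ℓ) where
  open CommutativeRing R
  open RingNotation rawRing using (ι)
  field
    1/_        : (n : ℕ) .{{_ : NonZero n}} → Carrier
    1/-inverse : (n : ℕ) .{{_ : NonZero n}} → ι n * (1/ n) ≈ 1#

-- Polynomials in x are lists of coefficients in order of increasing degree.
-- Trailing zeros are allowed, so equality is equality of all coefficients.
module Polynomial {a ℓ} (A : RawRing a ℓ) where
  open RawRing A

  Poly : Set a
  Poly = List Carrier

  coeff : Poly → ℕ → Carrier
  coeff []      _       = 0#
  coeff (a ∷ p) zero    = a
  coeff (a ∷ p) (suc i) = coeff p i

  addPoly : Poly → Poly → Poly
  addPoly []      q       = q
  addPoly (a ∷ p) []      = a ∷ p
  addPoly (a ∷ p) (b ∷ q) = (a + b) ∷ addPoly p q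

  mulPoly : Poly → Poly → Poly
  mulPoly []      q = []
  mulPoly (a ∷ p) q = addPoly (map (a *_) q) (0# ∷ mulPoly p q)

  constant : Carrier → Poly
  constant a = a ∷ []

  X : Poly
  X = 0# ∷ 1# ∷ []

  polyRing : RawRing a ℓ
  polyRing = record
    { Carrier = Poly
    ; _≈_     = λ p q → ∀ i → coeff p i ≈ coeff q i
    ; _+_     = addPoly
    ; _*_     = mulPoly
    ; -_      = map (-_)
    ; 0#      = []
    ; 1#      = constant 1#
    }

-- Formal power series in t; f n is the coefficient of tⁿ.
module PowerSeries {a ℓ} (A : RawRing a ℓ) where
  open RawRing A
  open RingNotation A using (∑)

  seriesRing : RawRing a ℓ
  seriesRing = record
    { Carrier = ℕ → Carrier
    ; _≈_     = λ f g → ∀ n → f n ≈ g n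
    ; _+_     = λ f g n → f n + g n
    ; _*_     = λ f g n → ∑ 0 n (λ k → f k * g (n ∸ k))
    ; -_      = λ f n → - f n
    ; 0#      = λ _ → 0#
    ; 1#      = constantSeries 1#
    }
    module _ where
    constantSeries : Carrier → ℕ → Carrier
    constantSeries c zero    = c
    constantSeries c (suc n) = 0#

-- Here 1/! n is to be the inverse of n! in A.
module ExponentialSeries {a ℓ} (A : RawRing a ℓ) (1/! : ℕ → RawRing.Carrier A) where
  open RawRing A
  open RingNotation A
  open PowerSeries A
  module S = RawRing seriesRing
  module SN = RingNotation seriesRing

  -- The series (1 + ƛt)^(y/ƛ), understood as Σₙ (y|ƛ)ₙ tⁿ/n!; this is e^(yt)
  -- when ƛ = 0.
  degExp : Carrier → Carrier → S.Carrier
  degExp ƛ y n = falling ƛ y n * 1/! n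

  -- The series e^g = Σₖ gᵏ/k!, for g with zero constant term: then gᵏ has no
  -- terms of degree below k, so only k ≤ n contribute to the coefficient of tⁿ.
  exp : S.Carrier → S.Carrier
  exp g n = ∑ 0 n (λ k → 1/! k * (g SN.^ k) n)

  -- The number aₙ in f = Σₙ aₙ tⁿ/n!.
  egfCoeff : S.Carrier → ℕ → Carrier
  egfCoeff f n = ι (n !) * f n

module Degenerate {c ℓ} (R : CommutativeRing c ℓ) (Q : ℚAlgebra R) where
  open CommutativeRing R public using (Carrier; _*_)
  open CommutativeRing R using (rawRing; 1#)
  open ℚAlgebra Q

  1/! : ℕ → Carrier
  1/! n = (1/ (n !)) {{n !≢0}}

  open RingNotation rawRing public using (ι; ∑; _^_)
  open Polynomial rawRing public using (Poly; coeff; constant; X; polyRing)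
  open RawRing polyRing public using () renaming (_≈_ to _≈ₚ_; _*_ to _*ₚ_)
  open RingNotation polyRing public using () renaming (∑ to ∑ₚ; _^_ to _^ₚ_)

  module P = RawRing polyRing
  module PN = RingNotation polyRing

  -- (x)ₙ is expanded in R[x].
  S₁ : ℕ → ℕ → Carrier
  S₁ n k = coeff (PN.falling P.1# X n) k

  module R⟦t⟧ where
    open PowerSeries rawRing public
    open RawRing seriesRing public using (_+_; -_) renaming (_*_ to _·_; 1# to one)
    open RingNotation seriesRing public using () renaming (_^_ to _↑_)
    open ExponentialSeries rawRing 1/! public

  module R[x]⟦t⟧ where
    open PowerSeries polyRing public
    open RawRing seriesRing public using (_+_; -_) renaming (_*_ to _·_; 1# to one)
    open ExponentialSeries polyRing (λ n → constant (1/! n)) public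

  S₂ : Carrier → ℕ → ℕ → Carrier
  S₂ ƛ n k = egfCoeff (constantSeries (1/! k) · (degExp ƛ 1# + - one) ↑ k) n
    where open R⟦t⟧

  -- S₂ʳ r ƛ n k is S_{2,r}(n+r, k+r | ƛ): the shift by r is left implicit.
  S₂ʳ : ℕ → Carrier → ℕ → ℕ → Carrier
  S₂ʳ r ƛ n k =
    egfCoeff (constantSeries (1/! k) · (degExp ƛ (ι r) · (degExp ƛ 1# + - one) ↑ k)) n
    where open R⟦t⟧

  -- The defining generating function is a power series in t over R[x].
  Bel : ℕ → Carrier → ℕ → Poly
  Bel r ƛ n =
    egfCoeff (degExp ƛₚ (PN.ι r) · exp (constantSeries X · (degExp ƛₚ P.1# + - one))) n
    where
    open R[x]⟦t⟧
    ƛₚ = constant ƛ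

{-# OPTIONS --safe #-}

-- As E = (1 + ƛt)^(1/ƛ) - 1 has no constant term, multiplying e^(xE) by
-- D = (1 + ƛt)^(r/ƛ) and reading off xᵏtⁿ gives D Eᵏ/k!, which is the first
-- identity.  For the second, D (Eᵏ/k!) is a binomial convolution of S₂ with the
-- falling factorials (r|ƛ)ⱼ, and these are the homogenisations
-- Σₗ S₁(j,l) rˡ ƛ^(j-l) of (x)ⱼ = Σₗ S₁(j,l) xˡ.
module Submission where

open import Defs
open import Algebra.Bundles using (CommutativeRing; Monoid)
import Algebra.Construct.Pointwise as Pointwise
import Algebra.Morphism.RingMonomorphism as RingMonomorphism
open import Algebra.Morphism.Structures
  using (IsRingHomomorphism; IsRingMonomorphism; module MonoidMorphisms)
open import Data.Fin.Base using (Fin; zero; suc; toℕ)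
open import Data.Fin.Properties using (toℕ≤pred[n])
open import Data.List.Base using ([]; _∷_; map)
open import Data.Nat.Base as ℕ using (ℕ; zero; suc; _∸_; _!; _≤_; _<_; z≤n; s≤s)
open import Data.Nat.Combinatorics using (_C_; nCk≡n!/k![n-k]!; k![n∸k]!∣n!)
open import Data.Nat.DivMod using (m/n*n≡m)
import Data.Nat.Properties as ℕ
open import Data.Product.Base using (_,_)
open import Function.Base using (_∘_)
open import Relation.Binary.PropositionalEquality.Core as ≡ using (_≡_)
import Relation.Binary.Reasoning.Setoid as SetoidReasoning

-- Monoid homomorphisms and finite sums.

module MonoidHomomorphism {a ℓ₁ b ℓ₂} (M : Monoid a ℓ₁) (N : Monoid b ℓ₂) where
  private
    module M = Monoid M
    module N = Monoid N
  open import Algebra.Definitions.RawMonoid M.rawMonoid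
    using () renaming (_×_ to _×ᴹ_; sum to sumᴹ)
  open import Algebra.Definitions.RawMonoid N.rawMonoid
    using () renaming (_×_ to _×ᴺ_; sum to sumᴺ)
  open MonoidMorphisms M.rawMonoid N.rawMonoid

  module _ {φ} (φ-hom : IsMonoidHomomorphism φ) where
    open IsMonoidHomomorphism φ-hom

    ×-homo : ∀ n x → φ (n ×ᴹ x) N.≈ n ×ᴺ φ x
    ×-homo zero    x = ε-homo
    ×-homo (suc n) x = N.trans (homo x (n ×ᴹ x)) (N.∙-congˡ (×-homo n x))

    sum-homo : ∀ n (x : Fin n → M.Carrier) → φ (sumᴹ x) N.≈ sumᴺ (φ ∘ x)
    sum-homo zero    x = ε-homo
    sum-homo (suc n) x = N.trans (homo _ _) (N.∙-congˡ (sum-homo n (x ∘ suc)))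

-- Changing the limits of finite sums.

module Summation {c ℓ} (R : CommutativeRing c ℓ) where
  open CommutativeRing R
  open RingNotation rawRing
  open import Algebra.Properties.Semiring.Sum semiring public
    using (sum-cong-≋; sum-replicate-zero; *-distribˡ-sum; ∑-comm; ∑-distrib-+)

  ∑-cong : ∀ a b f g → (∀ i → f i ≈ g i) → ∑ a b f ≈ ∑ a b g
  ∑-cong a b f g f≈g =
    sum-cong-≋ {suc b ∸ a} {λ i → f (a ℕ.+ toℕ i)} {λ i → g (a ℕ.+ toℕ i)}
      λ i → f≈g (a ℕ.+ toℕ i)

  ∑₀-cong : ∀ n f g → (∀ i → i ≤ n → f i ≈ g i) → ∑ 0 n f ≈ ∑ 0 n g
  ∑₀-cong n f g f≈g =
    sum-cong-≋ {suc n} {λ i → f (toℕ i)} {λ i → g (toℕ i)} λ i → f≈g (toℕ i) (toℕ≤pred[n] i)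

  ∑₀-zero : ∀ n f → (∀ i → i ≤ n → f i ≈ 0#) → ∑ 0 n f ≈ 0#
  ∑₀-zero n f f≈0 = trans (∑₀-cong n f (λ _ → 0#) f≈0) (sum-replicate-zero (suc n))

  -- The case `b < a` is covered too: the right side is then empty, and the left side has only
  -- vanishing terms.
  ∑-dropˡ : ∀ a b f → (∀ i → i < a → f i ≈ 0#) → ∑ 0 b f ≈ ∑ a b f
  ∑-dropˡ a b = go a (suc b)
    where
    -- The induction is on the number `n` of terms rather than on the last index, since truncated
    -- subtraction computes on both counts; each step shifts `f` by one.
    go : ∀ a n f → (∀ i → i < a → f i ≈ 0#) →
         sum {n} (λ i → f (toℕ i)) ≈ sum {n ∸ a} (λ i → f (a ℕ.+ toℕ i))
    go zero    n       f f≈0 = refl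
    go (suc a) zero    f f≈0 = refl
    go (suc a) (suc n) f f≈0 =
      trans (+-congʳ (f≈0 0 (s≤s z≤n)))
        (trans (+-identityˡ (sum {n} (λ i → f (suc (toℕ i)))))
               (go a n (λ i → f (suc i)) λ i i<a → f≈0 (suc i) (s≤s i<a)))

  -- This gives sums of varying length a common upper limit, so that their order can be exchanged.
  ∑-extendʳ : ∀ {m n} f → m ≤ n → (∀ i → m < i → f i ≈ 0#) → ∑ 0 m f ≈ ∑ 0 n f
  ∑-extendʳ {zero}  {n}     f m≤n       f≈0 =
    +-congˡ (sym (trans
      (sum-cong-≋ {n} {λ i → f (suc (toℕ i))} {λ _ → 0#} λ i → f≈0 (suc (toℕ i)) (s≤s z≤n))
      (sum-replicate-zero n)))
  ∑-extendʳ {suc m} {suc n} f (s≤s m≤n) f≈0 =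
    +-congˡ (∑-extendʳ (λ i → f (suc i)) m≤n λ i m<i → f≈0 (suc i) (s≤s m<i))

-- The commutative ring of formal power series.

module Series {c ℓ} (R : CommutativeRing c ℓ) where
  open CommutativeRing R
  open RingNotation rawRing
  open PowerSeries rawRing public
  open Summation R
  open SetoidReasoning setoid
  open import Algebra.Solver.Ring.NaturalCoefficients.Default commutativeSemiring
    using (solve; _:+_; _:*_; _:=_)

  private
    module S = CommutativeRing (Pointwise.commutativeRing ℕ R)
    variable
      f f′ g g′ : ℕ → Carrier

  infixl 7 _·_
  -- This unfolds to the product of `seriesRing`, so laws proved for it are laws of that ring.
  _·_ : (ℕ → Carrier) → (ℕ → Carrier) → ℕ → Carrier
  f · g = λ n → ∑ 0 n (λ k → f k * g (n ∸ k))

  -- From the decomposition of a series into `f 0` plus t times `tail f` comes `(f · g) (suc n) = f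
  -- 0 * g (suc n) + (tail f · g) n`, which holds by computation and drives the inductions below.
  tail : (ℕ → Carrier) → ℕ → Carrier
  tail f n = f (suc n)

  scale : Carrier → (ℕ → Carrier) → ℕ → Carrier
  scale a f n = a * f n

  -- The coefficient of tⁿ in a product sees only coefficients up to degree n. The truncated sums
  -- that define `exp` need this bounded form.
  ·-cong≤ : ∀ n → (∀ i → i ≤ n → f i ≈ f′ i) → (∀ i → i ≤ n → g i ≈ g′ i) →
            (f · g) n ≈ (f′ · g′) n
  ·-cong≤ {f} {f′} {g} {g′} n f≈f′ g≈g′ =
    ∑₀-cong n (λ i → f i * g (n ∸ i)) (λ i → f′ i * g′ (n ∸ i)) λ i i≤n →
      *-cong (f≈f′ i i≤n) (g≈g′ (n ∸ i) (ℕ.m∸n≤m n i))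

  ·-cong : (∀ n → f n ≈ f′ n) → (∀ n → g n ≈ g′ n) → ∀ n → (f · g) n ≈ (f′ · g′) n
  ·-cong {f} {f′} {g} {g′} f≈f′ g≈g′ n =
    ·-cong≤ {f} {f′} {g} {g′} n (λ i _ → f≈f′ i) (λ i _ → g≈g′ i)

  ·-zero : ∀ f g → (f · g) 0 ≈ f 0 * g 0
  ·-zero f g = +-identityʳ _

  -- Mirror image of the recursion that holds by computation: the last summand is split off instead
  -- of the first. Commutativity follows by playing one against the other.
  ·-suc : ∀ f g n → (f · g) (suc n) ≈ (f · tail g) n + f (suc n) * g 0
  ·-suc f g zero    = trans (+-congˡ (+-identityʳ _)) (+-congʳ (sym (·-zero f (tail g))))
  ·-suc f g (suc n) = begin
    f 0 * g (2 ℕ.+ n) + (tail f · g) (suc n)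
      ≈⟨ +-congˡ (·-suc (tail f) g n) ⟩
    f 0 * g (2 ℕ.+ n) + ((tail f · tail g) n + f (2 ℕ.+ n) * g 0)
      ≈⟨ +-assoc _ _ _ ⟨
    (f · tail g) (suc n) + f (2 ℕ.+ n) * g 0 ∎

  ·-comm : ∀ f g n → (f · g) n ≈ (g · f) n
  ·-comm f g zero    = +-congʳ (*-comm _ _)
  ·-comm f g (suc n) = begin
    f 0 * g (suc n) + (tail f · g) n ≈⟨ +-comm _ _ ⟩
    (tail f · g) n + f 0 * g (suc n) ≈⟨ +-cong (·-comm (tail f) g n) (*-comm _ _) ⟩
    (g · tail f) n + g (suc n) * f 0 ≈⟨ ·-suc g f n ⟨
    (g · f) (suc n)                  ∎

  ·-distribʳ : ∀ h f g n → ((f S.+ g) · h) n ≈ (f · h) n + (g · h) n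
  ·-distribʳ h f g n = trans
    (∑-cong 0 n (λ i → (f i + g i) * h (n ∸ i)) (λ i → f i * h (n ∸ i) + g i * h (n ∸ i))
      λ i → distribʳ (h (n ∸ i)) (f i) (g i))
    (∑-distrib-+ {suc n} (λ i → f (toℕ i) * h (n ∸ toℕ i)) (λ i → g (toℕ i) * h (n ∸ toℕ i)))

  ·-distribˡ : ∀ h f g n → (h · (f S.+ g)) n ≈ (h · f) n + (h · g) n
  ·-distribˡ h f g n = begin
    (h · (f S.+ g)) n     ≈⟨ ·-comm h (f S.+ g) n ⟩
    ((f S.+ g) · h) n     ≈⟨ ·-distribʳ h f g n ⟩
    (f · h) n + (g · h) n ≈⟨ +-cong (·-comm f h n) (·-comm g h n) ⟩
    (h · f) n + (h · g) n ∎

  scale-·ˡ : ∀ a f g n → (scale a f · g) n ≈ a * (f · g) n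
  scale-·ˡ a f g n = trans
    (∑-cong 0 n (λ i → a * f i * g (n ∸ i)) (λ i → a * (f i * g (n ∸ i)))
      λ i → *-assoc a (f i) (g (n ∸ i)))
    (sym (*-distribˡ-sum {suc n} a λ i → f (toℕ i) * g (n ∸ toℕ i)))

  scale-·ʳ : ∀ a f g n → (f · scale a g) n ≈ a * (f · g) n
  scale-·ʳ a f g n = begin
    (f · scale a g) n ≈⟨ ·-comm f (scale a g) n ⟩
    (scale a g · f) n ≈⟨ scale-·ˡ a g f n ⟩
    a * (g · f) n     ≈⟨ *-congˡ (·-comm g f n) ⟩
    a * (f · g) n     ∎

  -- Induction on the degree: the tail of `f · g` is `f 0` times `tail g` plus `tail f · g`, so
  -- distributivity and scaling leave the claim for `tail f` in one degree less.
  ·-assoc : ∀ f g h n → ((f · g) · h) n ≈ (f · (g · h)) n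
  ·-assoc f g h zero    = begin
    ((f · g) · h) 0   ≈⟨ ·-zero (f · g) h ⟩
    (f · g) 0 * h 0   ≈⟨ *-congʳ (·-zero f g) ⟩
    f 0 * g 0 * h 0   ≈⟨ *-assoc _ _ _ ⟩
    f 0 * (g 0 * h 0) ≈⟨ *-congˡ (·-zero g h) ⟨
    f 0 * (g · h) 0   ≈⟨ ·-zero f (g · h) ⟨
    (f · (g · h)) 0   ∎
  ·-assoc f g h (suc n) = begin
    (f · g) 0 * h (suc n) + ((scale (f 0) (tail g) S.+ (tail f · g)) · h) n
      ≈⟨ +-cong (*-congʳ (·-zero f g)) (·-distribʳ h (scale (f 0) (tail g)) (tail f · g) n) ⟩
    f 0 * g 0 * h (suc n) + ((scale (f 0) (tail g) · h) n + ((tail f · g) · h) n)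
      ≈⟨ +-congˡ (+-cong (scale-·ˡ (f 0) (tail g) h n) (·-assoc (tail f) g h n)) ⟩
    f 0 * g 0 * h (suc n) + (f 0 * (tail g · h) n + (tail f · (g · h)) n)
      ≈⟨ solve 5 (λ a b c d e → a :* b :* c :+ (a :* d :+ e) := a :* (b :* c :+ d) :+ e) refl
           (f 0) (g 0) (h (suc n)) ((tail g · h) n) ((tail f · (g · h)) n) ⟩
    f 0 * (g · h) (suc n) + (tail f · (g · h)) n ∎

  constantSeries-· : ∀ a f n → (constantSeries a · f) n ≈ a * f n
  constantSeries-· a f zero    = ·-zero (constantSeries a) f
  constantSeries-· a f (suc n) =
    trans (+-congˡ (∑₀-zero n (λ i → 0# * f (n ∸ i)) λ i _ → zeroˡ (f (n ∸ i)))) (+-identityʳ _)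

  seriesCommutativeRing : CommutativeRing c ℓ
  seriesCommutativeRing = record
    { isCommutativeRing = record
      { isRing = record
        { +-isAbelianGroup = S.+-isAbelianGroup
        ; *-cong           = ·-cong
        ; *-assoc          = ·-assoc
        ; *-identity       = 1-· , λ f n → trans (·-comm f (constantSeries 1#) n) (1-· f n)
        ; distrib          = ·-distribˡ , ·-distribʳ
        }
      ; *-comm = ·-comm
      }
    }
    where
    1-· : ∀ f n → (constantSeries 1# · f) n ≈ f n
    1-· f n = trans (constantSeries-· 1# f n) (*-identityˡ (f n))

-- The polynomial ring as a subring of the power series.

module Polynomials {c ℓ} (R : CommutativeRing c ℓ) where
  open CommutativeRing R
  open Polynomial rawRing public
  open Series R using
    (_·_; ·-cong; seriesRing; constantSeries; constantSeries-·; seriesCommutativeRing)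
  open SetoidReasoning setoid

  private
    module S = CommutativeRing seriesCommutativeRing

  coeff-+ : ∀ p q i → coeff (addPoly p q) i ≈ coeff p i + coeff q i
  coeff-+ []      q       i       = sym (+-identityˡ _)
  coeff-+ (a ∷ p) []      i       = sym (+-identityʳ _)
  coeff-+ (a ∷ p) (b ∷ q) zero    = refl
  coeff-+ (a ∷ p) (b ∷ q) (suc i) = coeff-+ p q i

  coeff-map : ∀ (φ : Carrier → Carrier) → φ 0# ≈ 0# →
              ∀ p i → coeff (map φ p) i ≈ φ (coeff p i)
  coeff-map φ φ0≈0 []      i       = sym φ0≈0
  coeff-map φ φ0≈0 (a ∷ p) zero    = refl
  coeff-map φ φ0≈0 (a ∷ p) (suc i) = coeff-map φ φ0≈0 p i

  coeff-* : ∀ p q i → coeff (mulPoly p q) i ≈ (coeff p · coeff q) i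
  coeff-* []      q i       = sym (S.zeroˡ (coeff q) i)
  coeff-* (a ∷ p) q i       = trans (coeff-+ (map (a *_) q) (0# ∷ mulPoly p q) i)
    (trans (+-congʳ (coeff-map (a *_) (zeroʳ a) q i)) (lemma i))
    where
    lemma : ∀ i → a * coeff q i + coeff (0# ∷ mulPoly p q) i ≈ (coeff (a ∷ p) · coeff q) i
    lemma zero    = refl
    lemma (suc i) = +-congˡ (coeff-* p q i)

  open import Algebra.Properties.Ring ring using (-0#≈0#)

  -- Equality of polynomials is by definition equality of coefficient sequences, so injectivity is
  -- immediate and all ring laws can be pulled back from power series.
  coeff-isRingMonomorphism : IsRingMonomorphism polyRing seriesRing coeff
  coeff-isRingMonomorphism = record
    { isRingHomomorphism = record
      { isSemiringHomomorphism = record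
        { isNearSemiringHomomorphism = record
          { +-isMonoidHomomorphism = record
            { isMagmaHomomorphism = record
              { isRelHomomorphism = record { cong = λ p≈q → p≈q }
              ; homo = coeff-+
              }
            ; ε-homo = λ _ → refl
            }
          ; *-homo = coeff-*
          }
        ; 1#-homo = λ { zero → refl ; (suc i) → refl }
        }
      ; -‿homo = coeff-map (-_) -0#≈0#
      }
    ; injective = λ p≈q → p≈q
    }

  polyCommutativeRing : CommutativeRing c ℓ
  polyCommutativeRing = record
    { isCommutativeRing =
        RingMonomorphism.isCommutativeRing coeff-isRingMonomorphism S.isCommutativeRing }

  constant-isRingHomomorphism : IsRingHomomorphism rawRing polyRing constant
  constant-isRingHomomorphism = record
    { isSemiringHomomorphism = record
      { isNearSemiringHomomorphism = record
        { +-isMonoidHomomorphism = record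
          { isMagmaHomomorphism = record
            { isRelHomomorphism = record { cong = λ { a≈b zero → a≈b ; a≈b (suc i) → refl } }
            ; homo = λ a b i → refl
            }
          ; ε-homo = λ { zero → refl ; (suc i) → refl }
          }
        ; *-homo = λ { a b zero → sym (+-identityʳ _) ; a b (suc i) → refl }
        }
      ; 1#-homo = λ i → refl
      }
    ; -‿homo = λ a i → refl
    }

  coeff-constant-* : ∀ a p i → coeff (mulPoly (constant a) p) i ≈ a * coeff p i
  coeff-constant-* a p i = begin
    coeff (mulPoly (constant a) p) i ≈⟨ coeff-* (constant a) p i ⟩
    (coeff (constant a) · coeff p) i
      ≈⟨ ·-cong {coeff (constant a)} {constantSeries a} {coeff p} {coeff p}
           (λ { zero → refl ; (suc i) → refl }) (λ _ → refl) i ⟩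
    (constantSeries a · coeff p) i   ≈⟨ constantSeries-· a (coeff p) i ⟩
    a * coeff p i                    ∎

  coeff-X-*-zero : ∀ p → coeff (mulPoly X p) 0 ≈ 0#
  coeff-X-*-zero p = trans (coeff-* X p 0) (trans (+-identityʳ _) (zeroˡ _))

  coeff-∷-*-suc : ∀ a p q i →
    coeff (mulPoly (a ∷ p) q) (suc i) ≈ a * coeff q (suc i) + coeff (mulPoly p q) i
  coeff-∷-*-suc a p q i =
    trans (coeff-+ (map (a *_) q) (0# ∷ mulPoly p q) (suc i))
          (+-congʳ (coeff-map (a *_) (zeroʳ a) q (suc i)))

  coeff-X-*-suc : ∀ p i → coeff (mulPoly X p) (suc i) ≈ coeff p i
  coeff-X-*-suc p i =
    trans (coeff-∷-*-suc 0# (constant 1#) p i)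
      (trans (+-cong (zeroˡ (coeff p (suc i))) (coeff-constant-* 1# p i))
        (trans (+-identityˡ (1# * coeff p i)) (*-identityˡ (coeff p i))))

-- Powers and exponentials of series.

module SeriesPowers {c ℓ} (R : CommutativeRing c ℓ) where
  open CommutativeRing R
  open RingNotation rawRing using (∑; _^_)
  open Series R
  open Summation R
  open RingNotation seriesRing public using () renaming (_^_ to _↑_)
  open SetoidReasoning setoid

  -- Each factor `g` is divisible by t and raises the order of the product by at least one.
  ↑-vanish : ∀ g → g 0 ≈ 0# → ∀ {k n} → n < k → (g ↑ k) n ≈ 0#
  ↑-vanish g g₀≈0 {suc k} {zero}  _         =
    trans (·-zero g (g ↑ k)) (trans (*-congʳ g₀≈0) (zeroˡ ((g ↑ k) 0)))
  ↑-vanish g g₀≈0 {suc k} {suc n} (s≤s n<k) = begin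
    g 0 * (g ↑ k) (suc n) + (tail g · (g ↑ k)) n
      ≈⟨ +-cong (*-congʳ g₀≈0) (∑₀-zero n (λ i → tail g i * (g ↑ k) (n ∸ i)) λ i _ →
           trans (*-congˡ (↑-vanish g g₀≈0 (ℕ.≤-<-trans (ℕ.m∸n≤m n i) n<k))) (zeroʳ (tail g i))) ⟩
    0# * (g ↑ k) (suc n) + 0# ≈⟨ +-identityʳ _ ⟩
    0# * (g ↑ k) (suc n)      ≈⟨ zeroˡ _ ⟩
    0#                        ∎

  -- Used to pull xᵏ out of (xE)ᵏ.
  constantSeries-·-↑ : ∀ a g k n → ((constantSeries a · g) ↑ k) n ≈ a ^ k * (g ↑ k) n
  constantSeries-·-↑ a g zero    n = sym (*-identityˡ _)
  constantSeries-·-↑ a g (suc k) n = begin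
    ((constantSeries a · g) · ((constantSeries a · g) ↑ k)) n
      ≈⟨ ·-cong {constantSeries a · g} {scale a g}
           {(constantSeries a · g) ↑ k} {scale (a ^ k) (g ↑ k)}
           (constantSeries-· a g) (constantSeries-·-↑ a g k) n ⟩
    (scale a g · scale (a ^ k) (g ↑ k)) n ≈⟨ scale-·ˡ a g (scale (a ^ k) (g ↑ k)) n ⟩
    a * (g · scale (a ^ k) (g ↑ k)) n     ≈⟨ *-congˡ (scale-·ʳ (a ^ k) g (g ↑ k) n) ⟩
    a * (a ^ k * (g ↑ suc k) n)           ≈⟨ *-assoc _ _ _ ⟨
    a ^ suc k * (g ↑ suc k) n             ∎

  module _ (1/! : ℕ → Carrier) where
    open ExponentialSeries rawRing 1/! using (exp)

    -- The coefficient of `exp g` in degree m sums over k up to m. Since `g ↑ k` vanishes below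
    -- degree k, every such sum may run up to the same `n`, and the sum over k then moves outside
    -- the product.
    ·-exp : ∀ f g → g 0 ≈ 0# → ∀ n →
            (f · exp g) n ≈ ∑ 0 n (λ k → 1/! k * (f · (g ↑ k)) n)
    ·-exp f g g₀≈0 n = begin
      (f · exp g) n
        ≈⟨ ·-cong≤ {f} {f} {exp g} {λ m → ∑ 0 n (term m)} n (λ _ _ → refl) (λ m m≤n →
             ∑-extendʳ (term m) m≤n λ k m<k →
               trans (*-congˡ (↑-vanish g g₀≈0 m<k)) (zeroʳ (1/! k))) ⟩
      ∑ 0 n (λ i → f i * ∑ 0 n (term (n ∸ i)))
        ≈⟨ ∑-cong 0 n (λ i → f i * ∑ 0 n (term (n ∸ i))) (λ i → ∑ 0 n (λ k → f i * term (n ∸ i) k))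
             (λ i → *-distribˡ-sum {suc n} (f i) (λ k → term (n ∸ i) (toℕ k))) ⟩
      ∑ 0 n (λ i → ∑ 0 n (λ k → f i * term (n ∸ i) k))
        ≈⟨ ∑-comm {suc n} {suc n} (λ i k → f (toℕ i) * term (n ∸ toℕ i) (toℕ k)) ⟩
      ∑ 0 n (λ k → ∑ 0 n (λ i → f i * term (n ∸ i) k))
        ≈⟨ ∑-cong 0 n (λ k → ∑ 0 n (λ i → f i * term (n ∸ i) k)) (λ k → 1/! k * (f · (g ↑ k)) n)
             (λ k → scale-·ʳ (1/! k) f (g ↑ k) n) ⟩
      ∑ 0 n (λ k → 1/! k * (f · (g ↑ k)) n) ∎
      where
      term : ℕ → ℕ → Carrier
      term m k = 1/! k * (g ↑ k) m

-- Transport of series along a ring homomorphism.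

module MapSeries {a ℓ₁ b ℓ₂} (R : CommutativeRing a ℓ₁) (T : CommutativeRing b ℓ₂)
  {φ} (φ-hom : IsRingHomomorphism (CommutativeRing.rawRing R) (CommutativeRing.rawRing T) φ) where
  private
    module R where
      open CommutativeRing R public
      open RingNotation rawRing public
      open Series R public
      open SeriesPowers R public
    module T where
      open CommutativeRing T public
      open RingNotation rawRing public
      open Series T public
      open SeriesPowers T public
      open Summation T public

  open IsRingHomomorphism φ-hom
  open SetoidReasoning T.setoid

  φ-× : ∀ n x → φ (n R.× x) T.≈ n T.× φ x
  φ-× = MonoidHomomorphism.×-homo R.+-monoid T.+-monoid +-isMonoidHomomorphism

  φ-· : ∀ f g n → φ ((f R.· g) n) T.≈ ((φ ∘ f) T.· (φ ∘ g)) n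
  φ-· f g n = T.trans
    (MonoidHomomorphism.sum-homo R.+-monoid T.+-monoid +-isMonoidHomomorphism
      (suc n) (λ i → f (toℕ i) R.* g (n ∸ toℕ i)))
    (T.∑-cong 0 n (λ i → φ (f i R.* g (n ∸ i))) (λ i → φ (f i) T.* φ (g (n ∸ i)))
      (λ i → *-homo (f i) (g (n ∸ i))))

  φ-constantSeries : ∀ x n → φ (R.constantSeries x n) T.≈ T.constantSeries (φ x) n
  φ-constantSeries x zero    = T.refl
  φ-constantSeries x (suc n) = 0#-homo

  φ-↑ : ∀ g g′ → (∀ n → φ (g n) T.≈ g′ n) → ∀ k n → φ ((g R.↑ k) n) T.≈ (g′ T.↑ k) n
  φ-↑ g g′ φg≈g′ zero    zero    = 1#-homo
  φ-↑ g g′ φg≈g′ zero    (suc n) = 0#-homo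
  φ-↑ g g′ φg≈g′ (suc k) n       = T.trans (φ-· g (g R.↑ k) n)
    (T.·-cong {φ ∘ g} {g′} {φ ∘ (g R.↑ k)} {g′ T.↑ k} φg≈g′ (φ-↑ g g′ φg≈g′ k) n)

  -- The image of `y` is taken up to equality, so that `PN.ι r` may stand for `constant (ι r)`.
  φ-falling : ∀ ƛ y y′ → φ y T.≈ y′ → ∀ n → φ (R.falling ƛ y n) T.≈ T.falling (φ ƛ) y′ n
  φ-falling ƛ y y′ φy≈y′ zero    = 1#-homo
  φ-falling ƛ y y′ φy≈y′ (suc n) = begin
    φ (R.falling ƛ y n R.* (y R.+ R.- (n R.× ƛ)))
      ≈⟨ *-homo _ _ ⟩
    φ (R.falling ƛ y n) T.* φ (y R.+ R.- (n R.× ƛ))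
      ≈⟨ T.*-cong (φ-falling ƛ y y′ φy≈y′ n) (+-homo _ _) ⟩
    T.falling (φ ƛ) y′ n T.* (φ y T.+ φ (R.- (n R.× ƛ)))
      ≈⟨ T.*-congˡ (T.+-cong φy≈y′ (T.trans (-‿homo _) (T.-‿cong (φ-× n ƛ)))) ⟩
    T.falling (φ ƛ) y′ (suc n) ∎

-- The division in the factorial formula for `n C k` is exact, so it can be multiplied out.
nCk*k![n∸k]!≡n! : ∀ {n k} → k ≤ n → (n C k) ℕ.* (k ! ℕ.* (n ∸ k) !) ≡ n !
nCk*k![n∸k]!≡n! {n} {k} k≤n = ≡.trans
  (≡.cong (ℕ._* (k ! ℕ.* (n ∸ k) !)) (nCk≡n!/k![n-k]! k≤n))
  (m/n*n≡m {{k ℕ.!* (n ∸ k) !≢0}} (k![n∸k]!∣n! k≤n))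

-- Stirling numbers and degenerate falling factorials.

module DegenerateProperties {c ℓ} (R : CommutativeRing c ℓ) (Q : ℚAlgebra R) where
  open Degenerate R Q
  open CommutativeRing R hiding (Carrier; _*_)
  open RingNotation rawRing using (_×_; falling)
  open Series R
  open SeriesPowers R
  open Summation R
  open Polynomials R using (polyCommutativeRing; constant-isRingHomomorphism;
    coeff-+; coeff-constant-*; coeff-X-*-zero; coeff-X-*-suc)
  open MapSeries R polyCommutativeRing constant-isRingHomomorphism
  open SetoidReasoning setoid
  open import Algebra.Properties.Ring ring using (-‿distribˡ-*)
  open import Algebra.Properties.Semiring.Mult semiring using (×-assoc-*; ×-congʳ; ×1-homo-*)
  open import Algebra.Solver.Ring.NaturalCoefficients.Default commutativeSemiring
    using (solve; con; _:+_; _:*_; _:=_)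

  private
    module P′ = CommutativeRing polyCommutativeRing

  ι!*1/!≈1 : ∀ n → ι (n !) * 1/! n ≈ 1#
  ι!*1/!≈1 n = ℚAlgebra.1/-inverse Q (n !) {{n ℕ.!≢0}}

  fallingₚ : ℕ → Poly
  fallingₚ = PN.falling P.1# X

  -- The triangular recurrence S₁(n+1,i) = S₁(n,i-1) - n S₁(n,i), from multiplying (x)ₙ by x - n.
  -- The index shift stays a product with `X`, which spares a case distinction on `i`.
  S₁-suc : ∀ n i → S₁ (suc n) i ≈ coeff (X *ₚ fallingₚ n) i + - ι n * S₁ n i
  S₁-suc n i = begin
    coeff (p *ₚ (X P.+ P.- (n PN.× P.1#))) i
      ≈⟨ P′.distribˡ p X (P.- (n PN.× P.1#)) i ⟩
    coeff ((p *ₚ X) P.+ (p *ₚ (P.- (n PN.× P.1#)))) i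
      ≈⟨ P′.+-cong {p *ₚ X} {X *ₚ p} {p *ₚ (P.- (n PN.× P.1#))} {constant (- ι n) *ₚ p}
           (P′.*-comm p X) lemma i ⟩
    coeff ((X *ₚ p) P.+ (constant (- ι n) *ₚ p)) i
      ≈⟨ coeff-+ (X *ₚ p) (constant (- ι n) *ₚ p) i ⟩
    coeff (X *ₚ p) i + coeff (constant (- ι n) *ₚ p) i
      ≈⟨ +-congˡ (coeff-constant-* (- ι n) p i) ⟩
    coeff (X *ₚ p) i + - ι n * coeff p i ∎
    where
    p = fallingₚ n
    lemma : (p *ₚ (P.- (n PN.× P.1#))) ≈ₚ (constant (- ι n) *ₚ p)
    lemma j = trans (P′.*-comm p (P.- (n PN.× P.1#)) j)
      (P′.*-cong {P.- (n PN.× P.1#)} {constant (- ι n)} {p} {p}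
        (P′.-‿cong {n PN.× P.1#} {constant (ι n)} (λ l → sym (φ-× n 1# l))) (λ _ → refl) j)

  -- By the recurrence, (x)ₙ has degree at most n.
  S₁-vanish : ∀ {n i} → n < i → S₁ n i ≈ 0#
  S₁-vanish {zero}  {suc i} _         = refl
  S₁-vanish {suc n} {suc i} (s≤s n<i) = begin
    S₁ (suc n) (suc i)
      ≈⟨ S₁-suc n (suc i) ⟩
    coeff (X *ₚ fallingₚ n) (suc i) + - ι n * S₁ n (suc i)
      ≈⟨ +-cong (trans (coeff-X-*-suc (fallingₚ n) i) (S₁-vanish n<i))
                (trans (*-congˡ (S₁-vanish (ℕ.m<n⇒m<1+n n<i))) (zeroʳ (- ι n))) ⟩
    0# + 0#
      ≈⟨ +-identityˡ 0# ⟩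
    0# ∎

  module _ (ƛ y : Carrier) where
    private
      ƛ^ : ℕ → Carrier
      ƛ^ = ƛ ^_

      y^* : (ℕ → Carrier) → ℕ → Carrier
      y^* f l = y ^ l * f l

    -- The right side is the coefficient of tⁿ in the product of Σ yˡ S₁(n,l) tˡ and Σ ƛʲ tʲ.
    -- Multiplying it by y - nƛ amounts to `shift` for the part with y and `pad` for the part with
    -- ƛ, and the recurrence for `S₁` joins the two.
    falling-S₁ : ∀ n → falling ƛ y n ≈ ∑ 0 n (λ l → y ^ l * S₁ n l * ƛ ^ (n ∸ l))
    falling-S₁ zero    = solve 0 (con 1 := con 1 :* con 1 :* con 1 :+ con 0) refl
    falling-S₁ (suc n) = begin
      falling ƛ y n * (y + - (n × ƛ))
        ≈⟨ *-congʳ (falling-S₁ n) ⟩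
      H * (y + - (n × ƛ))
        ≈⟨ *-congˡ (+-congˡ -nƛ) ⟩
      H * (y + - ι n * ƛ)
        ≈⟨ solve 4 (λ h y m ƛ → h :* (y :+ m :* ƛ) := y :* h :+ m :* (ƛ :* h)) refl H y (- ι n) ƛ ⟩
      y * H + - ι n * (ƛ * H)
        ≈⟨ +-cong shift (*-congˡ pad) ⟨
      (G · ƛ^) (suc n) + - ι n * (F · ƛ^) (suc n)
        ≈⟨ +-congˡ (scale-·ˡ (- ι n) F ƛ^ (suc n)) ⟨
      (G · ƛ^) (suc n) + (scale (- ι n) F · ƛ^) (suc n)
        ≈⟨ ·-distribʳ ƛ^ G (scale (- ι n) F) (suc n) ⟨
      ((λ l → G l + scale (- ι n) F l) · ƛ^) (suc n)
        ≈⟨ ·-cong {λ l → G l + scale (- ι n) F l} {y^* (S₁ (suc n))} {ƛ^} {ƛ^}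
             (λ l → sym (split l)) (λ _ → refl) (suc n) ⟩
      (y^* (S₁ (suc n)) · ƛ^) (suc n) ∎
      where
      F G : ℕ → Carrier
      F = y^* (S₁ n)
      G = y^* (coeff (X *ₚ fallingₚ n))

      H : Carrier
      H = (F · ƛ^) n

      -nƛ : - (n × ƛ) ≈ - ι n * ƛ
      -nƛ = trans (-‿cong (trans (×-congʳ n (sym (*-identityˡ ƛ))) (sym (×-assoc-* n 1# ƛ))))
                  (-‿distribˡ-* (ι n) ƛ)

      split : ∀ l → y^* (S₁ (suc n)) l ≈ G l + scale (- ι n) F l
      split l = trans (*-congˡ (S₁-suc n l))
        (solve 4 (λ u a m b → u :* (a :+ m :* b) := u :* a :+ m :* (u :* b)) refl
          (y ^ l) (coeff (X *ₚ fallingₚ n) l) (- ι n) (S₁ n l))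

      -- Multiplication by `X` moves S₁(n,l) to index l + 1, where it meets one more factor y; index
      -- 0 contributes nothing.
      shift : (G · ƛ^) (suc n) ≈ y * H
      shift = begin
        G 0 * ƛ^ (suc n) + (tail G · ƛ^) n
          ≈⟨ +-cong
               (trans (*-congʳ (trans (*-congˡ (coeff-X-*-zero (fallingₚ n))) (zeroʳ (y ^ 0))))
                      (zeroˡ (ƛ^ (suc n))))
               (·-cong {tail G} {scale y F} {ƛ^} {ƛ^}
                 (λ l → trans (*-congˡ (coeff-X-*-suc (fallingₚ n) l)) (*-assoc y (y ^ l) (S₁ n l)))
                 (λ _ → refl) n) ⟩
        0# + (scale y F · ƛ^) n ≈⟨ +-identityˡ _ ⟩
        (scale y F · ƛ^) n      ≈⟨ scale-·ˡ y F ƛ^ n ⟩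
        y * H                   ∎

      -- Passing from degree n to n + 1 raises every exponent of ƛ by one; the new summand, at l = n
      -- + 1, is zero by `S₁-vanish`.
      pad : (F · ƛ^) (suc n) ≈ ƛ * H
      pad = begin
        (F · ƛ^) (suc n)
          ≈⟨ ·-suc F ƛ^ n ⟩
        (F · scale ƛ ƛ^) n + F (suc n) * 1#
          ≈⟨ +-cong (scale-·ʳ ƛ F ƛ^ n)
               (trans (*-identityʳ _)
                 (trans (*-congˡ (S₁-vanish {n} {suc n} (ℕ.n<1+n n))) (zeroʳ (y ^ suc n)))) ⟩
        ƛ * H + 0#
          ≈⟨ +-identityʳ _ ⟩
        ƛ * H ∎

  -- Degenerate Stirling numbers of the second kind.

  module _ (ƛ : Carrier) where
    private
      E : ℕ → Carrier
      E = R⟦t⟧.degExp ƛ 1# R⟦t⟧.+ R⟦t⟧.- R⟦t⟧.one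

    degExp-1-zero : E 0 ≈ 0#
    degExp-1-zero = begin
      -- The value `1/! 0` is known only as an inverse of `ι 1`, that is of `1# + 0#`.
      1# * 1/! 0 + - 1#  ≈⟨ +-congʳ (*-congʳ (+-identityʳ 1#)) ⟨
      ι 1 * 1/! 0 + - 1# ≈⟨ +-congʳ (ι!*1/!≈1 0) ⟩
      1# + - 1#          ≈⟨ -‿inverseʳ 1# ⟩
      0#                 ∎

    S₂-vanish : ∀ {m k} → m < k → S₂ ƛ m k ≈ 0#
    S₂-vanish {m} {k} m<k = begin
      ι (m !) * (constantSeries (1/! k) · (E ↑ k)) m
        ≈⟨ *-congˡ (constantSeries-· (1/! k) (E ↑ k) m) ⟩
      ι (m !) * (1/! k * (E ↑ k) m)
        ≈⟨ *-congˡ (*-congˡ (↑-vanish E degExp-1-zero m<k)) ⟩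
      ι (m !) * (1/! k * 0#)
        ≈⟨ *-congˡ (zeroʳ (1/! k)) ⟩
      ι (m !) * 0#
        ≈⟨ zeroʳ (ι (m !)) ⟩
      0# ∎

    -- A product of exponential generating functions is a binomial convolution of their
    -- coefficients: Eᵏ/k! carries `S₂` and D carries (r|ƛ)ⱼ. The sum can start at `k` by
    -- `S₂-vanish`.
    S₂ʳ-convolution : ∀ r n k →
      S₂ʳ r ƛ n k ≈ ∑ k n (λ m → S₂ ƛ m k * ι (n C m) * falling ƛ (ι r) (n ∸ m))
    S₂ʳ-convolution r n k = begin
      ι (n !) * (C₀ · (D · (E ↑ k))) n
        -- Commuting D past Eᵏ brings Eᵏ next to 1/k!, and together they form `T`.
        ≈⟨ *-congˡ (·-cong {C₀} {C₀} {D · (E ↑ k)} {(E ↑ k) · D} (λ _ → refl) (·-comm D (E ↑ k)) n) ⟩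
      ι (n !) * (C₀ · ((E ↑ k) · D)) n
        ≈⟨ *-congˡ (·-assoc C₀ (E ↑ k) D n) ⟨
      ι (n !) * (T · D) n
        ≈⟨ *-distribˡ-sum {suc n} (ι (n !)) (λ m → T (toℕ m) * D (n ∸ toℕ m)) ⟩
      ∑ 0 n (λ m → ι (n !) * (T m * D (n ∸ m)))
        ≈⟨ ∑₀-cong n (λ m → ι (n !) * (T m * D (n ∸ m))) term step ⟩
      ∑ 0 n term
        ≈⟨ ∑-dropˡ k n term (λ m m<k → trans (*-congʳ
             (trans (*-congʳ (S₂-vanish m<k)) (zeroˡ (ι (n C m))))) (zeroˡ (falling ƛ (ι r) (n ∸ m)))) ⟩
      ∑ k n term ∎
      where
      C₀ D T term : ℕ → Carrier
      C₀ = constantSeries (1/! k)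
      D = R⟦t⟧.degExp ƛ (ι r)
      T = C₀ · (E ↑ k)
      term m = S₂ ƛ m k * ι (n C m) * falling ƛ (ι r) (n ∸ m)

      ι-factorial : ∀ {m} → m ≤ n → ι (n !) ≈ ι (n C m) * (ι (m !) * ι ((n ∸ m) !))
      ι-factorial {m} m≤n = begin
        ι (n !)                                    ≡⟨ ≡.cong ι (nCk*k![n∸k]!≡n! m≤n) ⟨
        ι ((n C m) ℕ.* (m ! ℕ.* (n ∸ m) !))        ≈⟨ ×1-homo-* (n C m) (m ! ℕ.* (n ∸ m) !) ⟩
        ι (n C m) * ι (m ! ℕ.* (n ∸ m) !)          ≈⟨ *-congˡ (×1-homo-* (m !) ((n ∸ m) !)) ⟩
        ι (n C m) * (ι (m !) * ι ((n ∸ m) !))      ∎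

      step : ∀ m → m ≤ n → ι (n !) * (T m * D (n ∸ m)) ≈ term m
      step m m≤n = begin
        ι (n !) * (T m * (u * 1/! (n ∸ m)))
          ≈⟨ *-congʳ (ι-factorial m≤n) ⟩
        ι (n C m) * (ι (m !) * ι ((n ∸ m) !)) * (T m * (u * 1/! (n ∸ m)))
          -- The factor m! turns `T m` into `S₂ ƛ m k`, while (n-m)! is set against its inverse from
          -- `D`.
          ≈⟨ solve 6 (λ c a b t u v → c :* (a :* b) :* (t :* (u :* v)) := a :* t :* c :* u :* (b :* v))
               refl (ι (n C m)) (ι (m !)) (ι ((n ∸ m) !)) (T m) u (1/! (n ∸ m)) ⟩
        term m * (ι ((n ∸ m) !) * 1/! (n ∸ m))
          ≈⟨ *-congˡ (ι!*1/!≈1 (n ∸ m)) ⟩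
        term m * 1#
          ≈⟨ *-identityʳ (term m) ⟩
        term m ∎
        where u = falling ƛ (ι r) (n ∸ m)

    S₂ʳ-expansion : ∀ r n k → S₂ʳ r ƛ n k ≈
      ∑ k n (λ m → ∑ 0 (n ∸ m) (λ l →
        ι r ^ l * ƛ ^ (n ∸ m ∸ l) * S₁ (n ∸ m) l * S₂ ƛ m k * ι (n C m)))
    S₂ʳ-expansion r n k = trans (S₂ʳ-convolution r n k)
      (∑-cong k n (λ m → S₂ ƛ m k * ι (n C m) * falling ƛ (ι r) (n ∸ m))
        (λ m → ∑ 0 (n ∸ m) (inner m)) λ m → begin
          a m * falling ƛ (ι r) (n ∸ m)
            ≈⟨ *-congˡ (falling-S₁ ƛ (ι r) (n ∸ m)) ⟩
          a m * ∑ 0 (n ∸ m) (row m)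
            ≈⟨ *-distribˡ-sum {suc (n ∸ m)} (a m) (λ l → row m (toℕ l)) ⟩
          ∑ 0 (n ∸ m) (λ l → a m * row m l)
            ≈⟨ ∑-cong 0 (n ∸ m) (λ l → a m * row m l) (inner m) (λ l →
                 solve 5 (λ y s x b c → b :* c :* (y :* s :* x) := y :* x :* s :* b :* c) refl
                   (ι r ^ l) (S₁ (n ∸ m) l) (ƛ ^ (n ∸ m ∸ l)) (S₂ ƛ m k) (ι (n C m))) ⟩
          ∑ 0 (n ∸ m) (inner m) ∎)
      where
      a : ℕ → Carrier
      a m = S₂ ƛ m k * ι (n C m)

      row inner : ℕ → ℕ → Carrier
      row m l = ι r ^ l * S₁ (n ∸ m) l * ƛ ^ (n ∸ m ∸ l)
      inner m l = ι r ^ l * ƛ ^ (n ∸ m ∸ l) * S₁ (n ∸ m) l * S₂ ƛ m k * ι (n C m)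

-- Expansion of the extended degenerate Bell polynomials.

module BellExpansion {c ℓ} (R : CommutativeRing c ℓ) (Q : ℚAlgebra R) where
  open Degenerate R Q
  open CommutativeRing R using (rawRing; 1#)
  open Polynomials R using (polyCommutativeRing; constant-isRingHomomorphism)
  open MapSeries R polyCommutativeRing constant-isRingHomomorphism
  open IsRingHomomorphism constant-isRingHomomorphism using (*-homo)
  open DegenerateProperties R Q using (degExp-1-zero)

  private
    module R′ where
      open CommutativeRing R public
      open Series R public
      open SeriesPowers R public
    module P′ where
      open CommutativeRing polyCommutativeRing public
      open Series polyCommutativeRing public
      open SeriesPowers polyCommutativeRing public
      open Summation polyCommutativeRing public

  open SetoidReasoning P′.setoid
  open import Algebra.Solver.Ring.NaturalCoefficients.Default P′.commutativeSemiring
    using (solve; _:*_; _:=_)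

  constant-degExp : ∀ ƛ y y′ → constant y ≈ₚ y′ → ∀ n →
    constant (R⟦t⟧.degExp ƛ y n) ≈ₚ R[x]⟦t⟧.degExp (constant ƛ) y′ n
  constant-degExp ƛ y y′ y≈y′ n = begin
    constant (R⟦t⟧.degExp ƛ y n)
      ≈⟨ *-homo (RingNotation.falling rawRing ƛ y n) (1/! n) ⟩
    constant (RingNotation.falling rawRing ƛ y n) *ₚ constant (1/! n)
      ≈⟨ P′.*-cong {constant (RingNotation.falling rawRing ƛ y n)} {PN.falling (constant ƛ) y′ n}
           {constant (1/! n)} {constant (1/! n)} (φ-falling ƛ y y′ y≈y′ n) (λ _ → R′.refl) ⟩
    R[x]⟦t⟧.degExp (constant ƛ) y′ n ∎

  module _ (r : ℕ) (ƛ : Carrier) (n : ℕ) where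
    private
      D E : ℕ → Carrier
      D = R⟦t⟧.degExp ƛ (ι r)
      E = R⟦t⟧.degExp ƛ 1# R⟦t⟧.+ R⟦t⟧.- R⟦t⟧.one

      Dₚ Eₚ G : ℕ → Poly
      Dₚ = R[x]⟦t⟧.degExp (constant ƛ) (PN.ι r)
      Eₚ = R[x]⟦t⟧.degExp (constant ƛ) P.1# R[x]⟦t⟧.+ R[x]⟦t⟧.- R[x]⟦t⟧.one
      G  = P′.constantSeries X P′.· Eₚ

      u : ℕ → Carrier
      u k = (D R′.· (E R′.↑ k)) n

      D≈ : ∀ i → constant (D i) ≈ₚ Dₚ i
      D≈ = constant-degExp ƛ (ι r) (PN.ι r) (φ-× r 1#)

      E≈ : ∀ i → constant (E i) ≈ₚ Eₚ i
      E≈ i = P′.+-cong {constant (R⟦t⟧.degExp ƛ 1# i)} {R[x]⟦t⟧.degExp (constant ƛ) P.1# i}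
        {P.- constant (R⟦t⟧.one i)} {P.- R[x]⟦t⟧.one i}
        (constant-degExp ƛ 1# P.1# (λ _ → R′.refl) i)
        (P′.-‿cong {constant (R⟦t⟧.one i)} {R[x]⟦t⟧.one i} (φ-constantSeries 1# i))

      G₀≈0 : G 0 ≈ₚ P.0#
      G₀≈0 = begin
        G 0                   ≈⟨ P′.constantSeries-· X Eₚ 0 ⟩
        X *ₚ Eₚ 0             ≈⟨ P′.*-congˡ {X} {Eₚ 0} {constant (E 0)} (λ i → R′.sym (E≈ 0 i)) ⟩
        X *ₚ constant (E 0)   ≈⟨ P′.*-congˡ {X} {constant (E 0)} {P.0#} E₀≈0 ⟩
        X *ₚ P.0#             ≈⟨ P′.zeroʳ X ⟩
        P.0#                  ∎
        where
        E₀≈0 : constant (E 0) ≈ₚ P.0#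
        E₀≈0 zero    = degExp-1-zero ƛ
        E₀≈0 (suc i) = R′.refl

      G^k≈ : ∀ k m → (G P′.↑ k) m ≈ₚ ((X ^ₚ k) *ₚ constant ((E R′.↑ k) m))
      G^k≈ k m = begin
        (G P′.↑ k) m                         ≈⟨ P′.constantSeries-·-↑ X Eₚ k m ⟩
        (X ^ₚ k) *ₚ (Eₚ P′.↑ k) m
          ≈⟨ P′.*-congˡ {X ^ₚ k} {constant ((E R′.↑ k) m)} {(Eₚ P′.↑ k) m} (φ-↑ E Eₚ E≈ k m) ⟨
        (X ^ₚ k) *ₚ constant ((E R′.↑ k) m)  ∎

      -- D and E have constant coefficients and x enters only through (xE)ᵏ = xᵏEᵏ, so the
      -- coefficient is xᵏ times an element computed over `R`.
      D·G^k≈ : ∀ k → (Dₚ P′.· (G P′.↑ k)) n ≈ₚ ((X ^ₚ k) *ₚ constant (u k))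
      D·G^k≈ k = begin
        (Dₚ P′.· (G P′.↑ k)) n
          ≈⟨ P′.·-cong {Dₚ} {λ i → constant (D i)}
               {G P′.↑ k} {P′.scale (X ^ₚ k) (λ m → constant ((E R′.↑ k) m))}
               (λ i j → R′.sym (D≈ i j)) (G^k≈ k) n ⟩
        ((λ i → constant (D i)) P′.· P′.scale (X ^ₚ k) (λ m → constant ((E R′.↑ k) m))) n
          ≈⟨ P′.scale-·ʳ (X ^ₚ k) (λ i → constant (D i)) (λ m → constant ((E R′.↑ k) m)) n ⟩
        (X ^ₚ k) *ₚ ((λ i → constant (D i)) P′.· (λ m → constant ((E R′.↑ k) m))) n
          ≈⟨ P′.*-congˡ {X ^ₚ k} {constant (u k)}
               {((λ i → constant (D i)) P′.· (λ m → constant ((E R′.↑ k) m))) n}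
               (φ-· D (E R′.↑ k) n) ⟨
        (X ^ₚ k) *ₚ constant (u k) ∎

      term : ℕ → Poly
      term k = (X ^ₚ k) *ₚ constant (S₂ʳ r ƛ n k)

      summand : ∀ k → (PN.ι (n !) *ₚ (constant (1/! k) *ₚ (Dₚ P′.· (G P′.↑ k)) n)) ≈ₚ term k
      summand k = begin
        PN.ι (n !) *ₚ (constant (1/! k) *ₚ (Dₚ P′.· (G P′.↑ k)) n)
          ≈⟨ P′.*-cong {PN.ι (n !)} {constant (ι (n !))}
               {constant (1/! k) *ₚ (Dₚ P′.· (G P′.↑ k)) n}
               {constant (1/! k) *ₚ ((X ^ₚ k) *ₚ constant (u k))}
               (λ j → R′.sym (φ-× (n !) 1# j))
               (P′.*-congˡ {constant (1/! k)} {(Dₚ P′.· (G P′.↑ k)) n} {(X ^ₚ k) *ₚ constant (u k)}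
                 (D·G^k≈ k)) ⟩
        constant (ι (n !)) *ₚ (constant (1/! k) *ₚ ((X ^ₚ k) *ₚ constant (u k)))
          ≈⟨ solve 4 (λ a b x u → a :* (b :* (x :* u)) := x :* (a :* (b :* u))) (λ _ → R′.refl)
               (constant (ι (n !))) (constant (1/! k)) (X ^ₚ k) (constant (u k)) ⟩
        (X ^ₚ k) *ₚ (constant (ι (n !)) *ₚ (constant (1/! k) *ₚ constant (u k)))
          ≈⟨ P′.*-congˡ {X ^ₚ k} {constant (S₂ʳ r ƛ n k)}
               {constant (ι (n !)) *ₚ (constant (1/! k) *ₚ constant (u k))} S₂ʳ≈ ⟨
        term k ∎
        where
        S₂ʳ≈ : constant (S₂ʳ r ƛ n k) ≈ₚ
               (constant (ι (n !)) *ₚ (constant (1/! k) *ₚ constant (u k)))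
        -- In degree zero a product of constants computes to `a * b + 0#`, once for each of the two
        -- products.
        S₂ʳ≈ zero    = R′.trans
          (R′.*-congˡ (R′.constantSeries-· (1/! k) (D R′.· (E R′.↑ k)) n))
          (R′.sym (R′.trans (R′.+-identityʳ _) (R′.*-congˡ (R′.+-identityʳ _))))
        S₂ʳ≈ (suc i) = R′.refl

    -- Apply `·-exp` to D and xE, then distribute n! over the sum: n!/k! times the coefficient of tⁿ
    -- in DEᵏ is `S₂ʳ r ƛ n k`.
    Bel-expansion : Bel r ƛ n ≈ₚ ∑ₚ 0 n (λ k → (X ^ₚ k) *ₚ constant (S₂ʳ r ƛ n k))
    Bel-expansion = begin
      Bel r ƛ n
        ≈⟨ P′.*-congˡ {PN.ι (n !)} {(Dₚ P′.· exp G) n} {∑ₚ 0 n a}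
             (P′.·-exp (λ k → constant (1/! k)) Dₚ G G₀≈0 n) ⟩
      PN.ι (n !) *ₚ ∑ₚ 0 n a
        ≈⟨ P′.*-distribˡ-sum {suc n} (PN.ι (n !)) (λ k → a (toℕ k)) ⟩
      ∑ₚ 0 n (λ k → PN.ι (n !) *ₚ a k)
        ≈⟨ P′.∑-cong 0 n (λ k → PN.ι (n !) *ₚ a k) term summand ⟩
      ∑ₚ 0 n term ∎
      where
      open R[x]⟦t⟧ using (exp)
      a : ℕ → Poly
      a k = constant (1/! k) *ₚ (Dₚ P′.· (G P′.↑ k)) n

-- Both identities together.

open import Data.Product.Base using (_×_)

theorem2p3 : ∀ {c ℓ} (R : CommutativeRing c ℓ) (Q : ℚAlgebra R) →
    let open Degenerate R Q in
    (ƛ : Carrier) (r n : ℕ) →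
      (Bel r ƛ n ≈ₚ ∑ₚ 0 n (λ k → (X ^ₚ k) *ₚ constant (S₂ʳ r ƛ n k)))
      ×
      (∑ₚ 0 n (λ k → (X ^ₚ k) *ₚ constant (S₂ʳ r ƛ n k))
        ≈ₚ
       ∑ₚ 0 n (λ k →
         constant (∑ k n (λ m → ∑ 0 (n ∸ m) (λ l →
           (ι r ^ l) * (ƛ ^ (n ∸ m ∸ l)) * S₁ (n ∸ m) l * S₂ ƛ m k * ι (n C m))))
         *ₚ (X ^ₚ k)))
theorem2p3 R Q ƛ r n =
  Bel-expansion r ƛ n ,
  -- The sums agree term by term: the power of x changes sides, and the coefficients match by
  -- `S₂ʳ-expansion`.
  P′.∑-cong 0 n (λ k → (X ^ₚ k) *ₚ constant (S₂ʳ r ƛ n k)) (λ k → constant (b k) *ₚ (X ^ₚ k))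
    λ k i → R′.trans (P′.*-comm (X ^ₚ k) (constant (S₂ʳ r ƛ n k)) i)
      (P′.*-congʳ {X ^ₚ k} {constant (S₂ʳ r ƛ n k)} {constant (b k)}
        (constant-cong (S₂ʳ-expansion ƛ r n k)) i)
  where
  open Degenerate R Q
  open BellExpansion R Q
  open DegenerateProperties R Q using (S₂ʳ-expansion)
  module R′ = CommutativeRing R
  module P′ where
    open CommutativeRing (Polynomials.polyCommutativeRing R) public
    open Summation (Polynomials.polyCommutativeRing R) public
  open IsRingHomomorphism (Polynomials.constant-isRingHomomorphism R)
    renaming (⟦⟧-cong to constant-cong)
  b : ℕ → Carrier
  b k = ∑ k n (λ m → ∑ 0 (n ∸ m) (λ l →
    (ι r ^ l) * (ƛ ^ (n ∸ m ∸ l)) * S₁ (n ∸ m) l * S₂ ƛ m k * ι (n C m)))
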